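{- Assume the weak form of Szpiro's conjecture. Let $u\geq 1$ be a positive integer, $r\geq1$, and $A_1,\dots,A_r$ fixed positive integers. Then the equation $$\prod_{i=1}^r A_i^{n_i}n_i! = x^2-u^2$$ has only finitely many solutions $(n_1,\dots,n_r,x)$ in positive integers $n_1,\dots,n_r$ and integers $x$.
   Context: For a nonzero integer $a$, $N(a)=\prod_{p\mid a}p$ is its radical. Weak form of Szpiro's conjecture: there exists a constant $s>0$ such that for all pairwise coprime nonzero integers $A,B,C$ with $A+B=C$ one has $|ABC|<N(ABC)^{s}$. -}

module Defs where

open import Data.Integer.Base as ℤ using (ℤ; +_; 0ℤ; ∣_∣)
open import Data.Integer.Coprimality using (Coprime)
open import Data.List.Base using (List; filter; upTo)
open import Data.List.Membership.Propositional using (_∈_)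
open import Data.Nat.Base using (ℕ; suc; _*_; _^_; _<_; _≥_; _!)
open import Data.Nat.Divisibility using (_∣?_)
open import Data.Nat.ListAction using (product)
open import Data.Nat.Primality using (prime?)
open import Data.Product.Base using (Σ; _×_; _,_)
open import Data.Rational.Base as ℚ using (ℚ; 0ℚ; ↥_; ↧ₙ_)
open import Data.Vec.Base using (Vec; toList; zipWith)
open import Data.Vec.Relation.Unary.All using (All)
open import Relation.Binary.PropositionalEquality.Core using (_≡_; _≢_)
open import Relation.Nullary.Decidable using (_×-dec_)

-- Meaningful only for a ≢ 0: every prime divisor of such an a is at most ∣ a ∣.
N : ℤ → ℕ
N a = product (filter (λ p → prime? p ×-dec (p ∣? ∣ a ∣)) (upTo (suc ∣ a ∣)))

-- For s = p / q in lowest terms, ∣ABC∣ < N(ABC)^s is expressed as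
-- ∣ABC∣^q < N(ABC)^p.  Restricting s to rationals is harmless: since
-- N(ABC) ≥ 1, the inequality persists when s is enlarged.
WeakSzpiro : Set
WeakSzpiro =
  Σ ℚ λ s → s ℚ.> 0ℚ ×
    (∀ (A B C : ℤ) → A ≢ 0ℤ → B ≢ 0ℤ → C ≢ 0ℤ →
     Coprime A B → Coprime A C → Coprime B C →
     A ℤ.+ B ≡ C →
     ∣ A ℤ.* B ℤ.* C ∣ ^ (↧ₙ s) < N (A ℤ.* B ℤ.* C) ^ ∣ ↥ s ∣)

FinitelyMany : {X : Set} → (X → Set) → Set
FinitelyMany {X} P = Σ (List X) λ xs → ∀ x → P x → x ∈ xs

factorialProduct : ∀ {r} → Vec ℕ r → Vec ℕ r → ℕ
factorialProduct A n = product (toList (zipWith (λ a k → a ^ k * k !) A n))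

IsSolution : ∀ {r} → ℕ → Vec ℕ r → Vec ℕ r × ℤ → Set
IsSolution u A (n , x) =
  All (_≥ 1) n × + factorialProduct A n ≡ x ℤ.^ 2 ℤ.- (+ u) ℤ.^ 2

{-# OPTIONS --safe #-}

-- Put X = ∣ x ∣ and let P be the product on the left.  Szpiro's inequality is applied to
-- (X − u) + 2u = X + u, divided through by the gcd g ∣ 2u: the product of the three terms
-- is 2uP / g³, and its prime factors divide 2u ∏ Aᵢ or are at most n = max nᵢ.  Since the
-- product of the primes up to n is exponentially bounded (Chebyshev, via central binomial
-- coefficients), n! ≤ P ≤ D cⁿ with D and c independent of the solution, so n is bounded.
module Submission where

open import Defs
open import Data.Integer.Base as ℤ using (ℤ; +_; -[1+_]; 0ℤ; ∣_∣)
import Data.Integer.Properties as ℤ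
open import Data.List.Base using (List; _∷_; [_]; _++_; map; upTo; concatMap; cartesianProductWith)
open import Data.List.Membership.Propositional using (_∈_; lose)
open import Data.List.Membership.Propositional.Properties using (∈-upTo⁺; ∈-map⁺; ∈-++⁺ˡ; ∈-++⁺ʳ; ∈-concatMap⁺; ∈-cartesianProductWith⁺; ∈-filter⁻)
import Data.List.Relation.Unary.All as List
open import Data.List.Relation.Unary.All using ([]; _∷_)
open import Data.List.Relation.Unary.AllPairs using ([]; _∷_)
open import Data.List.Relation.Unary.Any using (here)
open import Data.List.Relation.Unary.Unique.Propositional using (Unique)
open import Data.List.Relation.Unary.Unique.Propositional.Properties using (upTo⁺; filter⁺)
open import Data.Nat.Base
open import Data.Nat.Combinatorics using (_C_; nCk≡n!/k![n-k]!; k![n∸k]!∣n!; nCk+nC[k+1]≡[n+1]C[k+1])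
import Data.Nat.Coprimality as Coprime
open import Data.Nat.Coprimality using (Coprime)
open import Data.Nat.Divisibility
open import Data.Nat.DivMod using (m/n*n≡m)
open import Data.Nat.GCD using (gcd; gcd[m,n]∣m; gcd[m,n]∣n; gcd-greatest; gcd[m,n]≢0)
open import Data.Nat.ListAction using (product)
open import Data.Nat.Primality using (Prime; prime?; euclidsLemma; prime⇒irreducible; prime⇒nonTrivial)
open import Data.Nat.Properties
open import Data.Nat.Solver using (module +-*-Solver)
open import Data.Product.Base using (∃; _×_; _,_; proj₁; proj₂)
open import Data.Rational.Base using (↥_; ↧ₙ_)
open import Data.Sum.Base using (_⊎_; inj₁; inj₂; [_,_]′)
import Data.Sum.Base as Sum
open import Data.Vec.Base using (Vec; []; _∷_; toList)
open import Data.Vec.Relation.Unary.All using (All; []; _∷_)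
open import Function.Base using (_∘_; id)
open import Relation.Binary.PropositionalEquality using (_≡_; _≢_; refl; sym; trans; cong; cong₂; subst; module ≡-Reasoning)
open import Relation.Nullary.Decidable using (yes; no; _×-dec_)
open import Relation.Nullary.Negation using (contradiction)

open +-*-Solver using (solve; _:=_; _:+_; _:*_; con)

-- Prime divisors and the radical.

prime≢1 : ∀ {p} → Prime p → p ≢ 1
prime≢1 pp = nonTrivial⇒≢1 {{prime⇒nonTrivial pp}}

prime∣prime⇒≡ : ∀ {p q} → Prime p → Prime q → p ∣ q → p ≡ q
prime∣prime⇒≡ pp pq p∣q with prime⇒irreducible pq p∣q
... | inj₁ p≡1 = contradiction p≡1 (prime≢1 pp)
... | inj₂ p≡q = p≡q

prime∣^⇒∣ : ∀ {p} m k → Prime p → p ∣ m ^ k → p ∣ m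
prime∣^⇒∣ m zero    pp p∣1 = contradiction (∣1⇒≡1 p∣1) (prime≢1 pp)
prime∣^⇒∣ m (suc k) pp p∣  = [ id , prime∣^⇒∣ m k pp ]′ (euclidsLemma m (m ^ k) pp p∣)

prime∣!⇒≤ : ∀ {p} n → Prime p → p ∣ n ! → p ≤ n
prime∣!⇒≤ zero    pp p∣1 = contradiction (∣1⇒≡1 p∣1) (prime≢1 pp)
prime∣!⇒≤ (suc n) pp p∣  =
  [ ∣⇒≤ , m≤n⇒m≤1+n ∘ prime∣!⇒≤ n pp ]′ (euclidsLemma (suc n) (n !) pp p∣)

1≤p≤n⇒p∣n! : ∀ {p n} → 1 ≤ p → p ≤ n → p ∣ n !
1≤p≤n⇒p∣n! {suc p} _ p≤n = ∣-trans (m∣m*n (p !)) (m≤n⇒m!∣n! p≤n)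

-- Divide `m` by the first prime `p`: by Euclid's lemma every other listed prime divides the
-- quotient `q`, since dividing `p` would make it equal to `p`, against uniqueness.
product-uniquePrimes∣ : ∀ {ps} m → Unique ps → List.All Prime ps → List.All (_∣ m) ps → product ps ∣ m
product-uniquePrimes∣ m [] [] [] = 1∣ m
product-uniquePrimes∣ {p ∷ ps} m (p∉ps ∷ ups) (pp ∷ pps) (divides q m≡q*p ∷ ps∣m) =
  subst (p * product ps ∣_) (trans (*-comm p q) (sym m≡q*p))
    (*-monoʳ-∣ p (product-uniquePrimes∣ q ups pps (List.zipWith ∣q (p∉ps , List.zip (pps , ps∣m)))))
  where
  ∣q : ∀ {r} → p ≢ r × Prime r × r ∣ m → r ∣ q
  ∣q (p≢r , pr , r∣m) =
    [ id , (λ r∣p → contradiction (sym (prime∣prime⇒≡ pr pp r∣p)) p≢r) ]′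
      (euclidsLemma q p pr (subst (_ ∣_) m≡q*p r∣m))

-- `N a` is a product of distinct primes dividing `m`, hence divides `m`. This bounds the radical by
-- any convenient common multiple of the primes involved, squarefree or not.
N≤ : ∀ a m .{{_ : NonZero m}} → (∀ {p} → Prime p → p ∣ ∣ a ∣ → p ∣ m) → N a ≤ m
N≤ a m primes∣m =
  ∣⇒≤ (product-uniquePrimes∣ m (filter⁺ P? (upTo⁺ (suc ∣ a ∣)))
    (List.tabulate (proj₁ ∘ is))
    (List.tabulate (λ v∈ → primes∣m (proj₁ (is v∈)) (proj₂ (is v∈)))))
  where
  P? = λ p → prime? p ×-dec (p ∣? ∣ a ∣)
  is : ∀ {v} → v ∈ _ → Prime v × v ∣ ∣ a ∣
  is v∈ = proj₂ (∈-filter⁻ P? {xs = upTo (suc ∣ a ∣)} v∈)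

-- An exponentially bounded common multiple of the primes up to n.

nCk*[k!*[n∸k]!]≡n! : ∀ {n k} → k ≤ n → (n C k) * (k ! * (n ∸ k) !) ≡ n !
nCk*[k!*[n∸k]!]≡n! {n} {k} k≤n = trans
  (cong (_* (k ! * (n ∸ k) !)) (nCk≡n!/k![n-k]! k≤n))
  (m/n*n≡m (k![n∸k]!∣n! k≤n))
  where instance _ = k !* (n ∸ k) !≢0

nCk≢0 : ∀ {n k} → k ≤ n → NonZero (n C k)
nCk≢0 {n} {k} k≤n = ≢-nonZero λ C≡0 → ≢-nonZero⁻¹ (n !) {{n !≢0}}
  (trans (sym (nCk*[k!*[n∸k]!]≡n! k≤n)) (cong (_* (k ! * (n ∸ k) !)) C≡0))

2^[1+k]≡2^k+2^k : ∀ k → 2 ^ suc k ≡ 2 ^ k + 2 ^ k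
2^[1+k]≡2^k+2^k k = cong (λ z → 2 ^ k + z) (+-identityʳ (2 ^ k))

nCk≤2^n : ∀ n k → n C k ≤ 2 ^ n
nCk≤2^n zero    zero    = ≤-refl
nCk≤2^n zero    (suc k) = z≤n
nCk≤2^n (suc n) zero    = m^n>0 2 (suc n)
nCk≤2^n (suc n) (suc k) = begin
  suc n C suc k        ≡⟨ nCk+nC[k+1]≡[n+1]C[k+1] n k ⟨
  n C k + n C suc k    ≤⟨ +-mono-≤ (nCk≤2^n n k) (nCk≤2^n n (suc k)) ⟩
  2 ^ n + 2 ^ n        ≡⟨ 2^[1+k]≡2^k+2^k n ⟨
  2 ^ suc n            ∎
  where open ≤-Reasoning

-- `p` divides (2m)!, the product of the binomial coefficient and two copies of `m !`; as `p`
-- exceeds `m`, it cannot divide `m !`.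
prime∣centralBinomial : ∀ {p} m → Prime p → m < p → p ≤ m + m → p ∣ (m + m) C m
prime∣centralBinomial {p} m pp m<p p≤m+m
  with euclidsLemma ((m + m) C m) (m ! * (m + m ∸ m) !) pp
         (subst (p ∣_) (sym (nCk*[k!*[n∸k]!]≡n! (m≤m+n m m))) (1≤p≤n⇒p∣n! (≤-trans (s≤s z≤n) m<p) p≤m+m))
... | inj₁ p∣C = p∣C
... | inj₂ p∣!! = contradiction p≤m (<⇒≱ m<p)
  where
  p≤m : p ≤ m
  p≤m = [ prime∣!⇒≤ m pp , subst (p ≤_) (m+n∸n≡m m m) ∘ prime∣!⇒≤ (m + m ∸ m) pp ]′
    (euclidsLemma (m !) ((m + m ∸ m) !) pp p∣!!)

-- The factor added at step `k` accounts for the primes in the dyadic interval from 2^k (exclusive)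
-- to 2^(k+1).
primeCover : ℕ → ℕ
primeCover zero    = 1
primeCover (suc k) = primeCover k * ((2 ^ k + 2 ^ k) C (2 ^ k))

primeCover≢0 : ∀ k → NonZero (primeCover k)
primeCover≢0 zero    = _
primeCover≢0 (suc k) = m*n≢0 _ _ {{primeCover≢0 k}} {{nCk≢0 (m≤m+n (2 ^ k) (2 ^ k))}}

prime∣primeCover : ∀ {p} k → Prime p → p ≤ 2 ^ k → p ∣ primeCover k
prime∣primeCover zero pp p≤1 = contradiction p≤1 (<⇒≱ (nonTrivial⇒n>1 _ {{prime⇒nonTrivial pp}}))
prime∣primeCover {p} (suc k) pp p≤ with p ≤? 2 ^ k
... | yes p≤2^k = ∣m⇒∣m*n _ (prime∣primeCover k pp p≤2^k)
... | no  p≰2^k = ∣n⇒∣m*n (primeCover k)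
  (prime∣centralBinomial (2 ^ k) pp (≰⇒> p≰2^k) (subst (p ≤_) (2^[1+k]≡2^k+2^k k) p≤))

-- The new binomial coefficient is at most 2^(2·2^k) = 4^(2^k), which equals the bound for the
-- earlier factors, so each step squares the bound.
primeCover≤ : ∀ k → primeCover k ≤ 4 ^ (2 ^ k)
primeCover≤ zero    = s≤s z≤n
primeCover≤ (suc k) = begin
  primeCover k * ((2 ^ k + 2 ^ k) C (2 ^ k)) ≤⟨ *-mono-≤ (primeCover≤ k) (nCk≤2^n (2 ^ k + 2 ^ k) (2 ^ k)) ⟩
  4 ^ (2 ^ k) * 2 ^ (2 ^ k + 2 ^ k)          ≡⟨ cong (λ z → 4 ^ (2 ^ k) * 2 ^ z) (2^[1+k]≡2^k+2^k k) ⟨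
  4 ^ (2 ^ k) * 2 ^ (2 * 2 ^ k)              ≡⟨ cong ((4 ^ (2 ^ k)) *_) (^-*-assoc 2 2 (2 ^ k)) ⟨
  4 ^ (2 ^ k) * 4 ^ (2 ^ k)                  ≡⟨ ^-distribˡ-+-* 4 (2 ^ k) (2 ^ k) ⟨
  4 ^ (2 ^ k + 2 ^ k)                        ≡⟨ cong (4 ^_) (2^[1+k]≡2^k+2^k k) ⟨
  4 ^ (2 ^ suc k)                            ∎
  where open ≤-Reasoning

∃-power-of-two : ∀ n → ∃ λ k → n ≤ 2 ^ k × 2 ^ k ≤ suc (2 * n)
-- The `suc` in the upper bound is forced here: a power of two is at least 1 even for n = 0.
∃-power-of-two zero = 0 , z≤n , ≤-refl
∃-power-of-two (suc n) with ∃-power-of-two n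
... | k , n≤2^k , 2^k≤ with suc n ≤? 2 ^ k
...   | yes n<2^k = k , n<2^k , ≤-trans 2^k≤ (s≤s (*-monoʳ-≤ 2 (n≤1+n n)))
...   | no  n≮2^k =
  suc k
  , ≤-trans (+-mono-≤ (m^n>0 2 k) n≤2^k) (≤-reflexive (sym (2^[1+k]≡2^k+2^k k)))
  , ≤-trans (*-monoʳ-≤ 2 (<⇒≤ (≰⇒> n≮2^k))) (n≤1+n _)

-- Cover the primes up to a power of two between `n` and 2n+1; the constants come from 4^(2n+1) =
-- 4·16^n.
primes-bound : ∀ n → ∃ λ q → NonZero q × (∀ {p} → Prime p → p ≤ n → p ∣ q) × q ≤ 4 * 16 ^ n
primes-bound n with ∃-power-of-two n
... | k , n≤2^k , 2^k≤ =
  primeCover k , primeCover≢0 k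
  , (λ pp p≤n → prime∣primeCover k pp (≤-trans p≤n n≤2^k))
  , (begin
      primeCover k     ≤⟨ primeCover≤ k ⟩
      4 ^ (2 ^ k)      ≤⟨ ^-monoʳ-≤ 4 2^k≤ ⟩
      4 * 4 ^ (2 * n)  ≡⟨ cong (4 *_) (^-*-assoc 4 2 n) ⟨
      4 * 16 ^ n       ∎)
  where open ≤-Reasoning

-- Factorials outgrow exponentials.

^-distribʳ-* : ∀ k m n → (m * n) ^ k ≡ m ^ k * n ^ k
^-distribʳ-* zero    m n = refl
^-distribʳ-* (suc k) m n = trans (cong ((m * n) *_) (^-distribʳ-* k m n))
  (solve 4 (λ a b c d → (a :* b) :* (c :* d) := (a :* c) :* (b :* d)) refl m n (m ^ k) (n ^ k))

n<2^n : ∀ n → n < 2 ^ n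
n<2^n zero    = ≤-refl
n<2^n (suc n) = begin-strict
  1 + n          <⟨ +-mono-≤-< (m^n>0 2 n) (n<2^n n) ⟩
  2 ^ n + 2 ^ n  ≡⟨ 2^[1+k]≡2^k+2^k n ⟨
  2 ^ suc n      ∎
  where open ≤-Reasoning

-- Up to n = b the factor `b ^ b` suffices by itself; beyond that, each further factor `b` on the
-- left is met by a larger factor of the factorial.
b^n≤n!*b^b : ∀ b .{{_ : NonZero b}} n → b ^ n ≤ n ! * b ^ b
b^n≤n!*b^b b n with n ≤? b
... | yes n≤b = ≤-trans (^-monoʳ-≤ b n≤b) (m≤n*m (b ^ b) (n !) {{n !≢0}})
b^n≤n!*b^b b zero    | no n≰b = contradiction z≤n n≰b
b^n≤n!*b^b b (suc n) | no n≰b = begin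
  b * b ^ n              ≤⟨ *-mono-≤ (<⇒≤ (≰⇒> n≰b)) (b^n≤n!*b^b b n) ⟩
  suc n * (n ! * b ^ b)  ≡⟨ *-assoc (suc n) (n !) (b ^ b) ⟨
  suc n ! * b ^ b        ∎
  where open ≤-Reasoning

-- Taking base 2c in `b^n≤n!*b^b` leaves a spare 2^n after `c ^ n` is cancelled, and n < 2^n.
n!≤D*c^n⇒n<D*[2c]^[2c] : ∀ D c .{{_ : NonZero c}} n → n ! ≤ D * c ^ n → n < D * (2 * c) ^ (2 * c)
n!≤D*c^n⇒n<D*[2c]^[2c] D c n n!≤ = <-≤-trans (n<2^n n) (*-cancelʳ-≤ _ _ (c ^ n) (begin
  2 ^ n * c ^ n                      ≡⟨ ^-distribʳ-* n 2 c ⟨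
  (2 * c) ^ n                        ≤⟨ b^n≤n!*b^b (2 * c) n ⟩
  n ! * (2 * c) ^ (2 * c)            ≤⟨ *-monoˡ-≤ ((2 * c) ^ (2 * c)) n!≤ ⟩
  D * c ^ n * (2 * c) ^ (2 * c)      ≡⟨ solve 3 (λ a b d → a :* b :* d := a :* d :* b) refl D (c ^ n) _ ⟩
  D * (2 * c) ^ (2 * c) * c ^ n      ∎))
  where
  open ≤-Reasoning
  instance
    _ = m*n≢0 2 c
    _ = m^n≢0 c n

-- Szpiro's inequality for natural numbers.

m≤m^n : ∀ m n .{{_ : NonZero n}} → m ≤ m ^ n
m≤m^n zero      _       = z≤n
m≤m^n m@(suc _) (suc n) = m≤m*n m (m ^ n) {{m^n≢0 m n}}

-- The exponent `e` is the numerator of `s`; the denominator is at least 1, so dropping that power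
-- on the left only weakens the inequality. `e` is chosen before `a`, `b`, `m`, which makes the
-- later bounds uniform.
szpiro-coprime : WeakSzpiro → ∃ λ e → ∀ a b m .{{_ : NonZero a}} .{{_ : NonZero b}} .{{_ : NonZero m}} →
  Coprime a b → (∀ {p} → Prime p → p ∣ a * b * (a + b) → p ∣ m) → a * b * (a + b) ≤ m ^ e
szpiro-coprime (s , _ , szpiro) = ∣ ↥ s ∣ , bound
  where
  bound : ∀ a b m .{{_ : NonZero a}} .{{_ : NonZero b}} .{{_ : NonZero m}} →
    Coprime a b → (∀ {p} → Prime p → p ∣ a * b * (a + b) → p ∣ m) → a * b * (a + b) ≤ m ^ ∣ ↥ s ∣
  bound a@(suc _) b@(suc _) m c primes∣m = begin
    a * b * (a + b)             ≡⟨ ∣abc∣ ⟨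
    ∣ abc ∣                     ≤⟨ m≤m^n ∣ abc ∣ (↧ₙ s) ⟩
    ∣ abc ∣ ^ (↧ₙ s)            <⟨ szpiro (+ a) (+ b) (+ (a + b)) (λ ()) (λ ()) (λ ()) c
                                     (Coprime.sym (Coprime.coprime-+ (Coprime.sym c)))
                                     (Coprime.sym (subst (λ z → Coprime z b) (+-comm b a) (Coprime.coprime-+ c)))
                                     refl ⟩
    N abc ^ ∣ ↥ s ∣             ≤⟨ ^-monoˡ-≤ ∣ ↥ s ∣ (N≤ abc m (λ {p} pp p∣ → primes∣m pp (subst (p ∣_) ∣abc∣ p∣))) ⟩
    m ^ ∣ ↥ s ∣                 ∎
    where
    open ≤-Reasoning
    abc = + a ℤ.* + b ℤ.* + (a + b)
    ∣abc∣ : ∣ abc ∣ ≡ a * b * (a + b)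
    ∣abc∣ = trans (ℤ.abs-* (+ a ℤ.* + b) (+ (a + b))) (cong (_* (a + b)) (ℤ.abs-* (+ a) (+ b)))

-- Dividing both terms by their gcd `g` takes `g ^ 3` out of the product and leaves a coprime pair.
-- Bounding `g` by `b` is affordable because `b` will be the fixed number 2u.
szpiro-general : WeakSzpiro → ∃ λ e → ∀ a b m .{{_ : NonZero a}} .{{_ : NonZero b}} .{{_ : NonZero m}} →
  (∀ {p} → Prime p → p ∣ a * b * (a + b) → p ∣ m) → a * b * (a + b) ≤ b ^ 3 * m ^ e
szpiro-general ws with szpiro-coprime ws
... | e , szpiro = e , bound
  where
  bound : ∀ a b m .{{_ : NonZero a}} .{{_ : NonZero b}} .{{_ : NonZero m}} →
    (∀ {p} → Prime p → p ∣ a * b * (a + b) → p ∣ m) → a * b * (a + b) ≤ b ^ 3 * m ^ e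
  bound a b m primes∣m with gcd[m,n]∣m a b | gcd[m,n]∣n a b
  ... | divides a′ a≡ | divides b′ b≡ = begin
    a * b * (a + b)                     ≡⟨ abc≡ ⟩
    g ^ 3 * (a′ * b′ * (a′ + b′))       ≤⟨ *-mono-≤ (^-monoˡ-≤ 3 (∣⇒≤ (gcd[m,n]∣n a b)))
                                             (szpiro a′ b′ m coprime (λ {p} pp p∣ → primes∣m pp (subst (p ∣_) (sym abc≡) (∣n⇒∣m*n (g ^ 3) p∣)))) ⟩
    b ^ 3 * m ^ e                       ∎
    where
    open ≤-Reasoning
    g = gcd a b
    abc≡ : a * b * (a + b) ≡ g ^ 3 * (a′ * b′ * (a′ + b′))
    abc≡ = trans (cong₂ (λ x y → x * y * (x + y)) a≡ b≡)
      (solve 3 (λ x y d → (x :* d) :* (y :* d) :* (x :* d :+ y :* d) := (d :* (d :* (d :* con 1))) :* (x :* y :* (x :+ y))) refl a′ b′ g)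
    instance
      _ = ≢-nonZero (gcd[m,n]≢0 a b (inj₁ (≢-nonZero⁻¹ a)))
      _ = m*n≢0⇒m≢0 a′ {g} {{subst NonZero a≡ (≢-nonZero (≢-nonZero⁻¹ a))}}
      _ = m*n≢0⇒m≢0 b′ {g} {{subst NonZero b≡ (≢-nonZero (≢-nonZero⁻¹ b))}}
    coprime : Coprime a′ b′
    -- A common divisor `d` of the quotients makes d·g a common divisor of `a` and `b`, so d·g
    -- divides `g`.
    coprime {d} (d∣a′ , d∣b′) = ∣1⇒≡1 (*-cancelʳ-∣ {d} {1} g (subst (d * g ∣_) (sym (*-identityˡ g))
      (gcd-greatest (subst (d * g ∣_) (sym a≡) (*-monoˡ-∣ g d∣a′)) (subst (d * g ∣_) (sym b≡) (*-monoˡ-∣ g d∣b′)))))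

-- Size and prime factors of the left-hand side.

maximum : ∀ {r} → Vec ℕ r → ℕ
maximum []       = 0
maximum (k ∷ ks) = k ⊔ maximum ks

product≢0 : ∀ {r} {A : Vec ℕ r} → All (_≥ 1) A → NonZero (product (toList A))
product≢0 []          = _
product≢0 (a≥1 ∷ A≥1) = m*n≢0 _ _ {{>-nonZero a≥1}} {{product≢0 A≥1}}

maximum!≤factorialProduct : ∀ {r} (A n : Vec ℕ r) → All (_≥ 1) A → maximum n ! ≤ factorialProduct A n
maximum!≤factorialProduct []      []       []          = ≤-refl
-- The maximum is attained either at the head or in the tail; the remaining factors are at least 1.
maximum!≤factorialProduct (a ∷ A) (k ∷ ks) (a≥1 ∷ A≥1) = [ head , tail ]′ (⊔-sel k (maximum ks))
  where
  open ≤-Reasoning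
  F = factorialProduct A ks
  ih = maximum!≤factorialProduct A ks A≥1
  k!≤ : k ! ≤ a ^ k * k !
  k!≤ = m≤n*m (k !) (a ^ k) {{m^n≢0 a k {{>-nonZero a≥1}}}}
  head : k ⊔ maximum ks ≡ k → (k ⊔ maximum ks) ! ≤ a ^ k * k ! * F
  head eq = begin
    (k ⊔ maximum ks) ! ≡⟨ cong _! eq ⟩
    k !                ≤⟨ k!≤ ⟩
    a ^ k * k !        ≤⟨ m≤m*n _ F {{>-nonZero (≤-trans (1≤n! (maximum ks)) ih)}} ⟩
    a ^ k * k ! * F    ∎
  tail : k ⊔ maximum ks ≡ maximum ks → (k ⊔ maximum ks) ! ≤ a ^ k * k ! * F
  tail eq = begin
    (k ⊔ maximum ks) ! ≡⟨ cong _! eq ⟩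
    maximum ks !       ≤⟨ ih ⟩
    F                  ≤⟨ m≤n*m F (a ^ k * k !) {{>-nonZero (≤-trans (1≤n! k) k!≤)}} ⟩
    a ^ k * k ! * F    ∎

-- Separates the primes fixed in advance by `A` from those that vary with the solution but are at
-- most its largest exponent.
prime∣factorialProduct : ∀ {r p} (A n : Vec ℕ r) → Prime p → p ∣ factorialProduct A n →
  p ∣ product (toList A) ⊎ p ≤ maximum n
prime∣factorialProduct []      []       pp p∣1 = contradiction (∣1⇒≡1 p∣1) (prime≢1 pp)
prime∣factorialProduct (a ∷ A) (k ∷ ks) pp p∣ with euclidsLemma (a ^ k * k !) _ pp p∣
... | inj₂ p∣F = Sum.map (∣n⇒∣m*n a) (m≤n⇒m≤o⊔n k) (prime∣factorialProduct A ks pp p∣F)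
... | inj₁ p∣  with euclidsLemma (a ^ k) (k !) pp p∣
...   | inj₁ p∣a^k = inj₁ (∣m⇒∣m*n _ (prime∣^⇒∣ a k pp p∣a^k))
...   | inj₂ p∣k!  = inj₂ (m≤n⇒m≤n⊔o _ (prime∣!⇒≤ k pp p∣k!))

-- From the equation to a sum of two naturals.

solution⇒squares : ∀ F u x → + F ≡ x ℤ.^ 2 ℤ.- (+ u) ℤ.^ 2 → F + u * u ≡ ∣ x ∣ * ∣ x ∣
solution⇒squares F u x eq = ℤ.+-injective (begin
  + F ℤ.+ + (u * u)                              ≡⟨ cong (ℤ._+ + (u * u)) eq ⟩
  x ℤ.^ 2 ℤ.- (+ u) ℤ.^ 2 ℤ.+ + (u * u)          ≡⟨ cong₂ (λ y z → y ℤ.- z ℤ.+ + (u * u)) (square x) (square (+ u)) ⟩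
  + (∣ x ∣ * ∣ x ∣) ℤ.- + (u * u) ℤ.+ + (u * u)  ≡⟨ ℤ.+-assoc (+ (∣ x ∣ * ∣ x ∣)) (ℤ.- (+ (u * u))) (+ (u * u)) ⟩
  + (∣ x ∣ * ∣ x ∣) ℤ.+ (ℤ.- (+ (u * u)) ℤ.+ + (u * u)) ≡⟨ cong (ℤ._+_ (+ (∣ x ∣ * ∣ x ∣))) (ℤ.+-inverseˡ (+ (u * u))) ⟩
  + (∣ x ∣ * ∣ x ∣) ℤ.+ 0ℤ                       ≡⟨ ℤ.+-identityʳ _ ⟩
  + (∣ x ∣ * ∣ x ∣)                              ∎)
  where
  open ≡-Reasoning
  square : ∀ y → y ℤ.^ 2 ≡ + (∣ y ∣ * ∣ y ∣)
  square (+ n)    = trans (cong (ℤ._*_ (+ n)) (ℤ.*-identityʳ (+ n))) (sym (ℤ.pos-* n n))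
  square -[1+ n ] = cong (ℤ._*_ -[1+ n ]) (ℤ.*-identityʳ -[1+ n ])

difference-of-squares : ∀ F u X → 1 ≤ F → F + u * u ≡ X * X → ∃ λ a → NonZero a × a * (2 * u) * (a + 2 * u) ≡ 2 * u * F
difference-of-squares F u X 1≤F eq with X ≤? u
-- This would give X² ≤ u² < F + u² = X².
... | yes X≤u = contradiction (*-mono-≤ X≤u X≤u) (<⇒≱ (subst (u * u <_) eq (+-monoˡ-≤ (u * u) 1≤F)))
... | no  X≰u with m≤n⇒∃[o]m+o≡n (≰⇒> X≰u)
-- The witness is X - u, since X = 1 + u + c; then a + 2u = X + u, and a(a + 2u) = F.
...   | c , refl = suc c , _ , trans
  (solve 2 (λ a v → a :* (con 2 :* v) :* (a :+ con 2 :* v) := con 2 :* v :* (a :* (a :+ con 2 :* v))) refl (suc c) u)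
  (cong ((2 * u) *_) (+-cancelʳ-≡ (u * u) _ F (trans
    (solve 2 (λ a v → (con 1 :+ a) :* ((con 1 :+ a) :+ con 2 :* v) :+ v :* v := (con 1 :+ v :+ a) :* (con 1 :+ v :+ a)) refl c u)
    (sym eq))))

-- A uniform bound for the exponents.

maximum-bounded : WeakSzpiro → ∀ u → u ≥ 1 → ∀ {r} (A : Vec ℕ r) → All (_≥ 1) A →
  ∃ λ B → ∀ n x → IsSolution u A (n , x) → maximum n < B
maximum-bounded ws u u≥1 A A≥1 = D * (2 * c) ^ (2 * c) , λ n x sol → n!≤D*c^n⇒n<D*[2c]^[2c] D c (maximum n) (bound n x sol)
  where
  e = proj₁ (szpiro-general ws)
  instance
    _ : NonZero u
    _ = >-nonZero u≥1
    _ : NonZero (2 * u)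
    _ = m*n≢0 2 u
    _ : NonZero (product (toList A))
    _ = product≢0 A≥1
  -- `K` carries the primes independent of the solution. `D` and `c` arise by separating the part of
  -- (2u)^3 · (K·4·16^M)^e that depends on the maximum `M`.
  K = 2 * u * product (toList A)
  c = 16 ^ e
  D = (2 * u) ^ 3 * (K * 4) ^ e
  instance
    _ : NonZero K
    _ = m*n≢0 (2 * u) (product (toList A))
    _ : NonZero c
    _ = m^n≢0 16 e
  bound : ∀ n x → IsSolution u A (n , x) → maximum n ! ≤ D * c ^ maximum n
  bound n x (_ , eq) with primes-bound (maximum n)
                        | difference-of-squares (factorialProduct A n) u ∣ x ∣
                            (≤-trans (1≤n! (maximum n)) (maximum!≤factorialProduct A n A≥1))
                            (solution⇒squares (factorialProduct A n) u x eq)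
  ... | q , q≢0 , primes∣q , q≤ | a , a≢0 , abc≡ = begin
    maximum n !                               ≤⟨ maximum!≤factorialProduct A n A≥1 ⟩
    F                                         ≤⟨ m≤n*m F (2 * u) ⟩
    2 * u * F                                 ≡⟨ abc≡ ⟨
    a * (2 * u) * (a + 2 * u)                 ≤⟨ proj₂ (szpiro-general ws) a (2 * u) (K * q) primes∣ ⟩
    (2 * u) ^ 3 * (K * q) ^ e                 ≤⟨ *-monoʳ-≤ ((2 * u) ^ 3) (^-monoˡ-≤ e (*-monoʳ-≤ K q≤)) ⟩
    (2 * u) ^ 3 * (K * (4 * 16 ^ M)) ^ e      ≡⟨ cong (λ z → (2 * u) ^ 3 * z ^ e) (*-assoc K 4 (16 ^ M)) ⟨
    (2 * u) ^ 3 * (K * 4 * 16 ^ M) ^ e        ≡⟨ cong (((2 * u) ^ 3) *_) (^-distribʳ-* e (K * 4) (16 ^ M)) ⟩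
    (2 * u) ^ 3 * ((K * 4) ^ e * (16 ^ M) ^ e) ≡⟨ *-assoc ((2 * u) ^ 3) ((K * 4) ^ e) ((16 ^ M) ^ e) ⟨
    D * (16 ^ M) ^ e                          ≡⟨ cong (D *_) (trans (^-*-assoc 16 M e) (trans (cong (16 ^_) (*-comm M e)) (sym (^-*-assoc 16 e M)))) ⟩
    D * c ^ M                                 ∎
    where
    open ≤-Reasoning
    M = maximum n
    F = factorialProduct A n
    instance
      _ : NonZero a
      _ = a≢0
      _ : NonZero q
      _ = q≢0
      _ : NonZero (K * q)
      _ = m*n≢0 K q
    primes∣ : ∀ {p} → Prime p → p ∣ a * (2 * u) * (a + 2 * u) → p ∣ K * q
    primes∣ {p} pp p∣ with euclidsLemma (2 * u) F pp (subst (p ∣_) abc≡ p∣)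
    ... | inj₁ p∣2u = ∣m⇒∣m*n q (∣m⇒∣m*n _ p∣2u)
    ... | inj₂ p∣F  = [ ∣m⇒∣m*n q ∘ ∣n⇒∣m*n (2 * u) , ∣n⇒∣m*n K ∘ primes∣q pp ]′
                        (prime∣factorialProduct A n pp p∣F)

-- Enumeration of the solutions.

vectorsBelow : ℕ → ∀ r → List (Vec ℕ r)
vectorsBelow B zero    = [ [] ]
vectorsBelow B (suc r) = cartesianProductWith _∷_ (upTo B) (vectorsBelow B r)

∈-vectorsBelow : ∀ {B r} (n : Vec ℕ r) → maximum n < B → n ∈ vectorsBelow B r
∈-vectorsBelow []       _  = here refl
∈-vectorsBelow (k ∷ ks) m< = ∈-cartesianProductWith⁺ _∷_
  (∈-upTo⁺ (≤-<-trans (m≤m⊔n k _) m<))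
  (∈-vectorsBelow ks (≤-<-trans (m≤n⊔m k _) m<))

integersUpTo : ℕ → List ℤ
integersUpTo b = map +_ (upTo (suc b)) ++ map -[1+_] (upTo b)

∈-integersUpTo : ∀ {b} x → ∣ x ∣ ≤ b → x ∈ integersUpTo b
∈-integersUpTo     (+ k)    k≤b = ∈-++⁺ˡ (∈-map⁺ +_ (∈-upTo⁺ (s≤s k≤b)))
∈-integersUpTo {b} -[1+ k ] k<b = ∈-++⁺ʳ (map +_ (upTo (suc b))) (∈-map⁺ -[1+_] (∈-upTo⁺ k<b))

m≤m*m : ∀ m → m ≤ m * m
m≤m*m zero      = z≤n
m≤m*m m@(suc _) = m≤m*n m m

theorem3 : WeakSzpiro → (u : ℕ) → u ≥ 1 → (r : ℕ) → r ≥ 1 → (A : Vec ℕ r) → All (_≥ 1) A → FinitelyMany (IsSolution u A)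
theorem3 ws u u≥1 r _ A A≥1 = concatMap fibre (vectorsBelow B r) , complete
  where
  bounded = maximum-bounded ws u u≥1 A A≥1
  B = proj₁ bounded
  fibre : Vec ℕ r → List (Vec ℕ r × ℤ)
  -- For given exponents, ∣x∣ ≤ x² = P + u², where P is the left-hand side; the list may also
  -- contain non-solutions, as `FinitelyMany` asks only for a list containing every solution.
  fibre n = map (n ,_) (integersUpTo (factorialProduct A n + u * u))
  complete : ∀ s → IsSolution u A s → s ∈ concatMap fibre (vectorsBelow B r)
  complete (n , x) sol@(_ , eq) = ∈-concatMap⁺ fibre (lose (∈-vectorsBelow n (proj₂ bounded n x sol))
    (∈-map⁺ (n ,_) (∈-integersUpTo x (≤-trans (m≤m*m ∣ x ∣)
      (≤-reflexive (sym (solution⇒squares (factorialProduct A n) u x eq)))))))
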